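{- The class $\mathcal{K}$ of $\{\to\}$-subreducts of subresiduated lattices (viewed as algebras $(A,\to,1)$ of type $(2,0)$) is a quasivariety.
   Context: A subresiduated lattice is an algebra $(A,\wedge,\vee,\to,0,1)$ of type $(2,2,2,0,0)$ such that $(A,\wedge,\vee,0,1)$ is a bounded distributive lattice and for all $x,y,z\in A$: $x\to x=1$; $x\to y\le z\to(x\to y)$; $x\wedge(x\to y)\le y$; $z\to(x\wedge y)=(z\to x)\wedge(z\to y)$; $(x\vee y)\to z=(x\to z)\wedge(y\to z)$; $(x\to y)\wedge(y\to z)\le x\to z$. A $\{\to\}$-subreduct of a subresiduated lattice $A$ is any isomorphic image of a (nonempty) subalgebra of the reduct $(A,\to)$. Since $1=x\to x$, such a subalgebra always contains $1$, so it is viewed as an algebra of type $(2,0)$ with operations $\to,1$. A quasivariety is a class of algebras of a fixed type axiomatized by a set of quasi-equations. -}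

module Defs where

open import Level using (Level; 0ℓ; suc; _⊔_)
open import Algebra.Core using (Op₂)
open import Algebra.Definitions using (Congruent₂)
open import Algebra.Lattice.Structures using (IsDistributiveLattice)
open import Data.List.Base using (List)
open import Data.List.Relation.Unary.All using (All)
open import Data.Nat.Base using (ℕ)
open import Data.Product.Base using (Σ; Σ-syntax; ∃-syntax; _,_; proj₁)
open import Function.Base using (_on_)
open import Function.Bundles using (_⇔_)
open import Relation.Binary.Core using (Rel)
open import Relation.Binary.Definitions using (Maximum; Minimum; _Respects_)
open import Relation.Binary.Morphism.Structures using (IsRelIsomorphism)
open import Relation.Binary.Structures using (IsEquivalence)
open import Relation.Unary using (Pred; _∈_)
import Relation.Binary.Construct.NaturalOrder.Left as NaturalOrder
import Relation.Binary.Construct.On as On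

-- Algebras are setoid-based: `_≈_` plays the role of equality, and operations
-- are required to respect it.

record SubresiduatedLattice (ℓ : Level) : Set (suc ℓ) where
  infixr 5 _⇒_
  infixr 6 _∨_
  infixr 7 _∧_
  infix  4 _≈_
  field
    Carrier : Set ℓ
    _≈_     : Rel Carrier ℓ
    _∧_     : Op₂ Carrier
    _∨_     : Op₂ Carrier
    _⇒_     : Op₂ Carrier
    𝟘       : Carrier
    𝟙       : Carrier

  -- x ≤ y unfolds to x ≈ x ∧ y.
  open NaturalOrder _≈_ _∧_ public using (_≤_)

  field
    isDistributiveLattice : IsDistributiveLattice _≈_ _∨_ _∧_
    minimum               : Minimum _≤_ 𝟘
    maximum               : Maximum _≤_ 𝟙
    ⇒-cong                : Congruent₂ _≈_ _⇒_
    ⇒-refl                : ∀ x → (x ⇒ x) ≈ 𝟙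
    ⇒-persistent          : ∀ x y z → (x ⇒ y) ≤ (z ⇒ (x ⇒ y))
    ⇒-modusPonens         : ∀ x y → (x ∧ (x ⇒ y)) ≤ y
    ⇒-distribˡ-∧          : ∀ x y z → (z ⇒ (x ∧ y)) ≈ ((z ⇒ x) ∧ (z ⇒ y))
    ⇒-distribʳ-∨          : ∀ x y z → ((x ∨ y) ⇒ z) ≈ ((x ⇒ z) ∧ (y ⇒ z))
    ⇒-trans               : ∀ x y z → ((x ⇒ y) ∧ (y ⇒ z)) ≤ (x ⇒ z)

  open IsDistributiveLattice isDistributiveLattice public

-- Algebras (A , → , 1) of type (2 , 0), with no laws beyond congruence.

record Algebra (ℓ : Level) : Set (suc ℓ) where
  infixr 5 _⇒_
  infix  4 _≈_
  field
    Carrier       : Set ℓ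
    _≈_           : Rel Carrier ℓ
    _⇒_           : Op₂ Carrier
    𝟙             : Carrier
    isEquivalence : IsEquivalence _≈_
    ⇒-cong        : Congruent₂ _≈_ _⇒_

  open IsEquivalence isEquivalence public

record IsIsomorphism {ℓ₁ ℓ₂} (A : Algebra ℓ₁) (B : Algebra ℓ₂)
                     (f : Algebra.Carrier A → Algebra.Carrier B) : Set (ℓ₁ ⊔ ℓ₂) where
  private
    module A = Algebra A
    module B = Algebra B
  field
    isRelIsomorphism : IsRelIsomorphism A._≈_ B._≈_ f
    ⇒-homo           : ∀ x y → f (x A.⇒ y) B.≈ (f x B.⇒ f y)
    𝟙-homo           : f A.𝟙 B.≈ B.𝟙

_≅_ : ∀ {ℓ₁ ℓ₂} → Algebra ℓ₁ → Algebra ℓ₂ → Set (ℓ₁ ⊔ ℓ₂)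
A ≅ B = ∃[ f ] IsIsomorphism A B f

-- Nonempty subalgebras of the reduct (B , →).  Subsets of a setoid are
-- predicates that respect its equality.

record Subalgebra {ℓ} (B : SubresiduatedLattice ℓ) : Set (suc ℓ) where
  open SubresiduatedLattice B
  field
    member   : Pred Carrier ℓ
    respects : member Respects _≈_
    closed   : ∀ {x y} → x ∈ member → y ∈ member → (x ⇒ y) ∈ member
    nonempty : ∃[ x ] x ∈ member

  𝟙-member : 𝟙 ∈ member
  𝟙-member = let (x , x∈) = nonempty in respects (⇒-refl x) (closed x∈ x∈)

  algebra : Algebra ℓ
  algebra = record
    { Carrier       = Σ Carrier member
    ; _≈_           = _≈_ on proj₁
    ; _⇒_           = λ (x , x∈) (y , y∈) → (x ⇒ y) , closed x∈ y∈
    ; 𝟙             = 𝟙 , 𝟙-member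
    ; isEquivalence = On.isEquivalence proj₁ isEquivalence
    ; ⇒-cong        = ⇒-cong
    }

IsSubreduct : ∀ {ℓ} → Pred (Algebra ℓ) (suc ℓ)
IsSubreduct {ℓ} A =
  Σ[ B ∈ SubresiduatedLattice ℓ ] Σ[ S ∈ Subalgebra B ] Subalgebra.algebra S ≅ A

infixr 5 _⇒_
infix  4 _≐_

data Term : Set where
  var : ℕ → Term
  _⇒_ : Term → Term → Term
  𝟙   : Term

record Equation : Set where
  constructor _≐_
  field
    lhs : Term
    rhs : Term

-- The quasi-equation p₁ & … & pₙ ⟹ c; n = 0 is allowed.

record QuasiEquation : Set where
  constructor _⟹_
  field
    premises   : List Equation
    conclusion : Equation

module _ {ℓ} (A : Algebra ℓ) where
  private module A = Algebra A

  ⟦_⟧ : Term → (ℕ → A.Carrier) → A.Carrier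
  ⟦ var i ⟧ ρ = ρ i
  ⟦ s ⇒ t ⟧ ρ = ⟦ s ⟧ ρ A.⇒ ⟦ t ⟧ ρ
  ⟦ 𝟙     ⟧ ρ = A.𝟙

  Holds : (ℕ → A.Carrier) → Pred Equation ℓ
  Holds ρ (s ≐ t) = ⟦ s ⟧ ρ A.≈ ⟦ t ⟧ ρ

  Satisfies : Pred QuasiEquation ℓ
  Satisfies (ps ⟹ c) = ∀ ρ → All (Holds ρ) ps → Holds ρ c

IsQuasivariety : ∀ {ℓ k} → Pred (Algebra ℓ) k → Set (suc ℓ ⊔ k)
IsQuasivariety 𝒦 =
  Σ[ Γ ∈ Pred QuasiEquation 0ℓ ] (∀ A → A ∈ 𝒦 ⇔ (∀ q → q ∈ Γ → Satisfies A q))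

{-# OPTIONS --safe #-}

-- The axiomatising set consists of the quasi-equations derivable in equational
-- logic from the laws of subresiduated lattices.  Soundness of derivations gives
-- one direction.  Conversely, let A satisfy them all and let B be the
-- subresiduated lattice presented by the elements of A subject to the diagram
-- of A.  If two generators a and b become equal in B, a derivation of this uses
-- only finitely many elements and relations of A; replacing these elements by
-- variables turns it into a derivation of a quasi-equation, whose validity in A
-- gives a ≈ b.  So A embeds into B, with the generators as its image.

module Submission where

open import Level using (Level; 0ℓ; _⊔_)
open import Data.Fin.Base using (Fin; zero; suc)
open import Data.Fin.Patterns using (0F; 1F; 2F)
open import Data.List.Base using ([]; _∷_; _++_; [_])
open import Data.List.Membership.Propositional using () renaming (_∈_ to _∈ˡ_)
open import Data.List.Membership.Propositional.Properties using (∈-++⁺ˡ; ∈-++⁺ʳ)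
open import Data.List.Relation.Unary.All as All using (All; []; _∷_)
import Data.List.Relation.Unary.All.Properties as All
open import Data.List.Relation.Unary.Any using (here)
open import Data.Nat.Base using (ℕ; zero; suc)
open import Data.Product.Base using (∃-syntax; Σ-syntax; _×_; _,_; proj₁; proj₂)
open import Data.Vec.Base using ([]; _∷_; lookup)
open import Function.Base using (_∘_)
open import Function.Bundles using (mk⇔)
open import Relation.Binary.Core using (Rel)
open import Relation.Binary.PropositionalEquality as ≡
  using (_≡_; refl; cong₂; subst₂)
open import Relation.Binary.Morphism.Structures using (module IsRelIsomorphism)
open import Relation.Unary using (Pred; _∈_; _⊆_)
open import Defs

private variable
  a b r r′ ℓ : Level
  V : Set a
  W : Set b

-- Terms and equational logic of subresiduated lattices.

infixr 5 _⊸_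
infixr 6 _⋎_
infixr 7 _⋏_

data Operation : Set where
  meet join arrow : Operation

data Constant : Set where
  bottom top : Constant

data LatticeTerm (V : Set a) : Set a where
  gen   : V → LatticeTerm V
  const : Constant → LatticeTerm V
  op    : Operation → (s t : LatticeTerm V) → LatticeTerm V

pattern _⋏_ s t = op meet s t
pattern _⋎_ s t = op join s t
pattern _⊸_ s t = op arrow s t
pattern ⊥ = const bottom
pattern ⊤ = const top

bind : (V → LatticeTerm W) → LatticeTerm V → LatticeTerm W
bind σ (gen v)    = σ v
bind σ (const k)  = const k
bind σ (op o s t) = op o (bind σ s) (bind σ t)

rename : (V → W) → LatticeTerm V → LatticeTerm W
rename f = bind (gen ∘ f)

rename-bind : ∀ {U : Set r} (f : V → W) (σ : U → LatticeTerm V) t →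
              rename f (bind σ t) ≡ bind (rename f ∘ σ) t
rename-bind f σ (gen u)    = refl
rename-bind f σ (const k)  = refl
rename-bind f σ (op o s t) = cong₂ (op o) (rename-bind f σ s) (rename-bind f σ t)

private
  x y z : LatticeTerm (Fin 3)
  x = gen 0F
  y = gen 1F
  z = gen 2F

-- s ≤ t is encoded as the equation s = s ∧ t.
data Axiom : Rel (LatticeTerm (Fin 3)) 0ℓ where
  ∨-comm        : Axiom (x ⋎ y) (y ⋎ x)
  ∨-assoc       : Axiom ((x ⋎ y) ⋎ z) (x ⋎ (y ⋎ z))
  ∧-comm        : Axiom (x ⋏ y) (y ⋏ x)
  ∧-assoc       : Axiom ((x ⋏ y) ⋏ z) (x ⋏ (y ⋏ z))
  ∨-absorbs-∧   : Axiom (x ⋎ (x ⋏ y)) x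
  ∧-absorbs-∨   : Axiom (x ⋏ (x ⋎ y)) x
  ∨-distribˡ-∧  : Axiom (x ⋎ (y ⋏ z)) ((x ⋎ y) ⋏ (x ⋎ z))
  ∨-distribʳ-∧  : Axiom ((y ⋏ z) ⋎ x) ((y ⋎ x) ⋏ (z ⋎ x))
  ∧-distribˡ-∨  : Axiom (x ⋏ (y ⋎ z)) ((x ⋏ y) ⋎ (x ⋏ z))
  ∧-distribʳ-∨  : Axiom ((y ⋎ z) ⋏ x) ((y ⋏ x) ⋎ (z ⋏ x))
  minimum       : Axiom ⊥ (⊥ ⋏ x)
  maximum       : Axiom x (x ⋏ ⊤)
  ⇒-refl        : Axiom (x ⊸ x) ⊤
  ⇒-persistent  : Axiom (x ⊸ y) ((x ⊸ y) ⋏ (z ⊸ (x ⊸ y)))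
  ⇒-modusPonens : Axiom (x ⋏ (x ⊸ y)) ((x ⋏ (x ⊸ y)) ⋏ y)
  ⇒-distribˡ-∧  : Axiom (z ⊸ (x ⋏ y)) ((z ⊸ x) ⋏ (z ⊸ y))
  ⇒-distribʳ-∨  : Axiom ((x ⋎ y) ⊸ z) ((x ⊸ z) ⋏ (y ⊸ z))
  ⇒-trans       : Axiom ((x ⊸ y) ⋏ (y ⊸ z)) (((x ⊸ y) ⋏ (y ⊸ z)) ⋏ (x ⊸ z))

-- Only axioms are instantiated; premises are used as they stand, so the elements of `V` act as
-- constants. Thus `Derivable R` is equality in the subresiduated lattice presented by generators
-- `V` and relations `R`.
data Derivable {V : Set a} (R : Rel (LatticeTerm V) r) : Rel (LatticeTerm V) (a ⊔ r) where
  premise : ∀ {s t} → R s t → Derivable R s t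
  axiom   : ∀ {s t} → Axiom s t → (σ : Fin 3 → LatticeTerm V) →
            Derivable R (bind σ s) (bind σ t)
  refl    : ∀ {s} → Derivable R s s
  sym     : ∀ {s t} → Derivable R s t → Derivable R t s
  trans   : ∀ {s t u} → Derivable R s t → Derivable R t u → Derivable R s u
  op-cong : ∀ o {s s′ t t′} → Derivable R s s′ → Derivable R t t′ →
            Derivable R (op o s t) (op o s′ t′)

weaken : ∀ {R : Rel (LatticeTerm V) r} {R′ : Rel (LatticeTerm V) r′} →
         (∀ {s t} → R s t → R′ s t) → ∀ {s t} → Derivable R s t → Derivable R′ s t
weaken R⊆R′ (premise p)     = premise (R⊆R′ p)
weaken R⊆R′ (axiom α σ)     = axiom α σ
weaken R⊆R′ refl            = refl
weaken R⊆R′ (sym d)         = sym (weaken R⊆R′ d)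
weaken R⊆R′ (trans d e)     = trans (weaken R⊆R′ d) (weaken R⊆R′ e)
weaken R⊆R′ (op-cong o d e) = op-cong o (weaken R⊆R′ d) (weaken R⊆R′ e)

derivable-rename : ∀ {R : Rel (LatticeTerm V) r} {R′ : Rel (LatticeTerm W) r′} (f : V → W) →
                   (∀ {s t} → R s t → R′ (rename f s) (rename f t)) →
                   ∀ {s t} → Derivable R s t → Derivable R′ (rename f s) (rename f t)
derivable-rename f R→R′ (premise p) = premise (R→R′ p)
derivable-rename f R→R′ (axiom {s} {t} α σ) =
  subst₂ (Derivable _) (≡.sym (rename-bind f σ s)) (≡.sym (rename-bind f σ t))
    (axiom α (rename f ∘ σ))
derivable-rename f R→R′ refl            = refl
derivable-rename f R→R′ (sym d)         = sym (derivable-rename f R→R′ d)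
derivable-rename f R→R′ (trans d e)     =
  trans (derivable-rename f R→R′ d) (derivable-rename f R→R′ e)
derivable-rename f R→R′ (op-cong o d e) =
  op-cong o (derivable-rename f R→R′ d) (derivable-rename f R→R′ e)

-- Implicational terms as lattice terms; finiteness of derivations.

⌈_⌉ : Term → LatticeTerm ℕ
⌈ var i ⌉ = gen i
⌈ s ⇒ t ⌉ = ⌈ s ⌉ ⊸ ⌈ t ⌉
⌈ 𝟙 ⌉     = ⊤

data ⟪_⟫ (E : Pred Equation r) : Rel (LatticeTerm ℕ) r where
  embed : ∀ {s t} → (s ≐ t) ∈ E → ⟪ E ⟫ ⌈ s ⌉ ⌈ t ⌉

⟪⟫-mono : ∀ {E : Pred Equation r} {F : Pred Equation r′} → E ⊆ F →
          ∀ {s t} → ⟪ E ⟫ s t → ⟪ F ⟫ s t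
⟪⟫-mono E⊆F (embed p) = embed (E⊆F p)

-- A derivation is a finite tree: collect the equations at its premise leaves and concatenate the
-- lists at binary nodes.
compactness : ∀ {E : Pred Equation r} {s t} → Derivable ⟪ E ⟫ s t →
              ∃[ ps ] All E ps × Derivable ⟪ _∈ˡ ps ⟫ s t
compactness (premise (embed p)) = [ _ ] , p ∷ [] , premise (embed (here refl))
compactness (axiom α σ) = [] , [] , axiom α σ
compactness refl        = [] , [] , refl
compactness (sym d)     = let ps , hs , d′ = compactness d in ps , hs , sym d′
compactness (trans d e) =
  let ps , hs , d′ = compactness d
      qs , ks , e′ = compactness e
  in  ps ++ qs , All.++⁺ hs ks ,
      trans (weaken (⟪⟫-mono ∈-++⁺ˡ) d′) (weaken (⟪⟫-mono (∈-++⁺ʳ ps)) e′)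
compactness (op-cong o d e) =
  let ps , hs , d′ = compactness d
      qs , ks , e′ = compactness e
  in  ps ++ qs , All.++⁺ hs ks ,
      op-cong o (weaken (⟪⟫-mono ∈-++⁺ˡ) d′) (weaken (⟪⟫-mono (∈-++⁺ʳ ps)) e′)

-- Derivability is syntactic, so this set lives at level `0ℓ`, as `IsQuasivariety` demands;
-- quantifying over all lattices of level `ℓ` would not.
Valid : Pred QuasiEquation 0ℓ
Valid (ps ⟹ (s ≐ t)) = Derivable ⟪ _∈ˡ ps ⟫ ⌈ s ⌉ ⌈ t ⌉

-- Soundness in subresiduated lattices and their subreducts.

module Soundness (B : SubresiduatedLattice ℓ) where
  private module B = SubresiduatedLattice B

  operation : Operation → B.Carrier → B.Carrier → B.Carrier
  operation meet  = B._∧_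
  operation join  = B._∨_
  operation arrow = B._⇒_

  operation-cong : ∀ o {p p′ q q′} → p B.≈ p′ → q B.≈ q′ → operation o p q B.≈ operation o p′ q′
  operation-cong meet  = B.∧-cong
  operation-cong join  = B.∨-cong
  operation-cong arrow = B.⇒-cong

  constant : Constant → B.Carrier
  constant bottom = B.𝟘
  constant top    = B.𝟙

  eval : (V → B.Carrier) → LatticeTerm V → B.Carrier
  eval ρ (gen v)    = ρ v
  eval ρ (const k)  = constant k
  eval ρ (op o s t) = operation o (eval ρ s) (eval ρ t)

  eval-bind : ∀ (ρ : W → B.Carrier) (σ : V → LatticeTerm W) t →
              eval ρ (bind σ t) ≡ eval (eval ρ ∘ σ) t
  eval-bind ρ σ (gen v)    = refl
  eval-bind ρ σ (const k)  = refl
  eval-bind ρ σ (op o s t) = cong₂ (operation o) (eval-bind ρ σ s) (eval-bind ρ σ t)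

  axiom-sound : ∀ {s t} → Axiom s t → ∀ ρ → eval ρ s B.≈ eval ρ t
  axiom-sound ∨-comm        ρ = B.∨-comm _ _
  axiom-sound ∨-assoc       ρ = B.∨-assoc _ _ _
  axiom-sound ∧-comm        ρ = B.∧-comm _ _
  axiom-sound ∧-assoc       ρ = B.∧-assoc _ _ _
  axiom-sound ∨-absorbs-∧   ρ = B.∨-absorbs-∧ _ _
  axiom-sound ∧-absorbs-∨   ρ = B.∧-absorbs-∨ _ _
  axiom-sound ∨-distribˡ-∧  ρ = B.∨-distribˡ-∧ _ _ _
  axiom-sound ∨-distribʳ-∧  ρ = B.∨-distribʳ-∧ _ _ _
  axiom-sound ∧-distribˡ-∨  ρ = B.∧-distribˡ-∨ _ _ _
  axiom-sound ∧-distribʳ-∨  ρ = B.∧-distribʳ-∨ _ _ _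
  axiom-sound minimum       ρ = B.minimum _
  axiom-sound maximum       ρ = B.maximum _
  axiom-sound ⇒-refl        ρ = B.⇒-refl _
  axiom-sound ⇒-persistent  ρ = B.⇒-persistent _ _ _
  axiom-sound ⇒-modusPonens ρ = B.⇒-modusPonens _ _
  axiom-sound ⇒-distribˡ-∧  ρ = B.⇒-distribˡ-∧ _ _ _
  axiom-sound ⇒-distribʳ-∨  ρ = B.⇒-distribʳ-∨ _ _ _
  axiom-sound ⇒-trans       ρ = B.⇒-trans _ _ _

  sound : ∀ {R : Rel (LatticeTerm V) r} (ρ : V → B.Carrier) →
          (∀ {s t} → R s t → eval ρ s B.≈ eval ρ t) →
          ∀ {s t} → Derivable R s t → eval ρ s B.≈ eval ρ t
  sound ρ ⊨R (premise p) = ⊨R p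
  sound ρ ⊨R (axiom {s} {t} α σ) =
    subst₂ B._≈_ (≡.sym (eval-bind ρ σ s)) (≡.sym (eval-bind ρ σ t)) (axiom-sound α (eval ρ ∘ σ))
  sound ρ ⊨R refl            = B.refl
  sound ρ ⊨R (sym d)         = B.sym (sound ρ ⊨R d)
  sound ρ ⊨R (trans d e)     = B.trans (sound ρ ⊨R d) (sound ρ ⊨R e)
  sound ρ ⊨R (op-cong o d e) = operation-cong o (sound ρ ⊨R d) (sound ρ ⊨R e)

  module _ (S : Subalgebra B) where
    eval-⌈⌉ : ∀ ρ t → proj₁ (⟦ Subalgebra.algebra S ⟧ t ρ) ≡ eval (proj₁ ∘ ρ) ⌈ t ⌉
    eval-⌈⌉ ρ (var i) = refl
    eval-⌈⌉ ρ (s ⇒ t) = cong₂ B._⇒_ (eval-⌈⌉ ρ s) (eval-⌈⌉ ρ t)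
    eval-⌈⌉ ρ 𝟙       = refl

    subalgebra-satisfies : ∀ q → q ∈ Valid → Satisfies (Subalgebra.algebra S) q
    subalgebra-satisfies (ps ⟹ (s ≐ t)) d ρ hs =
      subst₂ B._≈_ (≡.sym (eval-⌈⌉ ρ s)) (≡.sym (eval-⌈⌉ ρ t)) (sound (proj₁ ∘ ρ) premises-hold d)
      where
      premises-hold : ∀ {u v} → ⟪ _∈ˡ ps ⟫ u v → eval (proj₁ ∘ ρ) u B.≈ eval (proj₁ ∘ ρ) v
      premises-hold (embed {u} {v} p) =
        subst₂ B._≈_ (eval-⌈⌉ ρ u) (eval-⌈⌉ ρ v) (All.lookup hs p)

-- Invariance of quasi-equations under isomorphism.

module _ {ℓ₁ ℓ₂} {A : Algebra ℓ₁} {B : Algebra ℓ₂} where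
  private
    module A = Algebra A
    module B = Algebra B

  -- Surjectivity pulls the assignment back to `A`, injectivity takes the premises along, and `f`
  -- carries the conclusion forward to `B`.
  satisfies-resp-≅ : A ≅ B → ∀ q → Satisfies A q → Satisfies B q
  satisfies-resp-≅ (f , f-iso) (ps ⟹ (s ≐ t)) A⊨q ρ hs =
    B.trans (B.sym (hom s)) (B.trans (⟦⟧-cong (A⊨q τ (All.map (λ {e} → reflect {e}) hs))) (hom t))
    where
    open IsIsomorphism f-iso
    open IsRelIsomorphism isRelIsomorphism renaming (cong to ⟦⟧-cong)

    τ : ℕ → A.Carrier
    τ i = proj₁ (surjective (ρ i))

    hom : ∀ u → f (⟦ A ⟧ u τ) B.≈ ⟦ B ⟧ u ρ
    hom (var i) = proj₂ (surjective (ρ i)) A.refl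
    hom (u ⇒ v) = B.trans (⇒-homo _ _) (B.⇒-cong (hom u) (hom v))
    hom 𝟙       = 𝟙-homo

    reflect : Holds B ρ ⊆ Holds A τ
    reflect {u ≐ v} h = injective (B.trans (hom u) (B.trans h (B.sym (hom v))))

-- Merging two environments.

double : ℕ → ℕ
double zero    = zero
double (suc n) = suc (suc (double n))

module _ {X : Set a} where
  -- Swapping the arguments at each step puts `ρ` at even indices and `τ` at odd ones, so that two
  -- derivations can share one environment.
  interleave : (ℕ → X) → (ℕ → X) → ℕ → X
  interleave ρ τ zero    = ρ zero
  interleave ρ τ (suc n) = interleave τ (ρ ∘ suc) n

  interleave-even : ∀ ρ τ n → interleave ρ τ (double n) ≡ ρ n
  interleave-even ρ τ zero    = refl
  interleave-even ρ τ (suc n) = interleave-even (ρ ∘ suc) (τ ∘ suc) n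

  infix 4 _↪_
  _↪_ : Rel (ℕ → X) a
  ρ ↪ τ = Σ[ f ∈ (ℕ → ℕ) ] ∀ i → τ (f i) ≡ ρ i

  ↪-interleaveˡ : ∀ ρ τ → ρ ↪ interleave ρ τ
  ↪-interleaveˡ ρ τ = double , interleave-even ρ τ

  ↪-interleaveʳ : ∀ ρ τ → τ ↪ interleave ρ τ
  -- Past index 0 the sequence is an interleaving that starts with `τ`, so the even case applies to
  -- it.
  ↪-interleaveʳ ρ τ = suc ∘ double , interleave-even τ (ρ ∘ suc)

renameᵗ : (ℕ → ℕ) → Term → Term
renameᵗ f (var i) = var (f i)
renameᵗ f (s ⇒ t) = renameᵗ f s ⇒ renameᵗ f t
renameᵗ f 𝟙       = 𝟙

⌈⌉-rename : ∀ f t → ⌈ renameᵗ f t ⌉ ≡ rename f ⌈ t ⌉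
⌈⌉-rename f (var i) = refl
⌈⌉-rename f (s ⇒ t) = cong₂ _⊸_ (⌈⌉-rename f s) (⌈⌉-rename f t)
⌈⌉-rename f 𝟙       = refl

-- The lattice presented by the diagram of `A`, and its conservativity.

module Envelope (A : Algebra ℓ) where
  private module A = Algebra A

  Environment : Set ℓ
  Environment = ℕ → A.Carrier

  Theory : Environment → Rel (LatticeTerm ℕ) ℓ
  Theory ρ = Derivable ⟪ Holds A ρ ⟫

  -- A relation instead of the substitution `rename ρ`: leaves need to match only up to the equality
  -- of `A`.
  data Instance (ρ : Environment) : LatticeTerm ℕ → LatticeTerm A.Carrier → Set ℓ where
    gen   : ∀ {i a} → ρ i A.≈ a → Instance ρ (gen i) (gen a)
    const : ∀ k → Instance ρ (const k) (const k)
    op    : ∀ o {s t s′ t′} → Instance ρ s s′ → Instance ρ t t′ →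
            Instance ρ (op o s t) (op o s′ t′)

  data Diagram : Rel (LatticeTerm A.Carrier) ℓ where
    diagram : ∀ ρ {u v s t} → Holds A ρ (u ≐ v) → Instance ρ ⌈ u ⌉ s → Instance ρ ⌈ v ⌉ t →
              Diagram s t

  infix 4 _∼_
  _∼_ : Rel (LatticeTerm A.Carrier) ℓ
  _∼_ = Derivable Diagram

  instance-bind : ∀ {ρ} {σ : V → LatticeTerm ℕ} {τ : V → LatticeTerm A.Carrier} →
                  (∀ v → Instance ρ (σ v) (τ v)) → ∀ t → Instance ρ (bind σ t) (bind τ t)
  instance-bind h (gen v)    = h v
  instance-bind h (const k)  = const k
  instance-bind h (op o s t) = op o (instance-bind h s) (instance-bind h t)

  instance-extend : ∀ {ρ τ} ((f , _) : ρ ↪ τ) {s s′} →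
                    Instance ρ s s′ → Instance τ (rename f s) s′
  instance-extend (f , f-extends) (gen {i} p) = gen (A.trans (A.reflexive (f-extends i)) p)
  instance-extend ρ↪τ             (const k)   = const k
  instance-extend ρ↪τ             (op o p q)  = op o (instance-extend ρ↪τ p) (instance-extend ρ↪τ q)

  ⟦⟧-rename : ∀ {ρ τ} ((f , _) : ρ ↪ τ) t → ⟦ A ⟧ (renameᵗ f t) τ ≡ ⟦ A ⟧ t ρ
  ⟦⟧-rename (f , f-extends) (var i) = f-extends i
  ⟦⟧-rename ρ↪τ             (s ⇒ t) = cong₂ A._⇒_ (⟦⟧-rename ρ↪τ s) (⟦⟧-rename ρ↪τ t)
  ⟦⟧-rename ρ↪τ             𝟙       = refl

  theory-extend : ∀ {ρ τ} ((f , _) : ρ ↪ τ) {s t} →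
                  Theory ρ s t → Theory τ (rename f s) (rename f t)
  theory-extend {ρ} {τ} ρ↪τ@(f , _) = derivable-rename f extend-premise
    where
    extend-premise : ∀ {s t} → ⟪ Holds A ρ ⟫ s t → ⟪ Holds A τ ⟫ (rename f s) (rename f t)
    extend-premise (embed {u} {v} h) =
      subst₂ ⟪ Holds A τ ⟫ (⌈⌉-rename f u) (⌈⌉-rename f v)
        (embed (subst₂ A._≈_ (≡.sym (⟦⟧-rename ρ↪τ u)) (≡.sym (⟦⟧-rename ρ↪τ v)) h))

  -- Equality of A need not be decidable, so the same element may be named by
  -- several variables; the theory of ρ identifies these names.
  common-instance : ∀ {ρ s t u} → Instance ρ s u → Instance ρ t u → Theory ρ s t
  common-instance (gen {i} p) (gen {j} q) =
    premise (embed {s = var i} {t = var j} (A.trans p (A.sym q)))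
  common-instance (const k)   (const .k)    = refl
  common-instance (op o p q)  (op .o p′ q′) = op-cong o (common-instance p p′) (common-instance q q′)

  -- A generator is named by a variable in a constant environment; at an operation the environments
  -- of both operands are merged.
  name : ∀ t → ∃[ ρ ] ∃[ s ] Instance ρ s t
  name (gen a)    = (λ _ → a) , gen 0 , gen A.refl
  name (const k)  = (λ _ → A.𝟙) , const k , const k
  name (op o s t) =
    let ρ , _ , p = name s
        τ , _ , q = name t
    in  interleave ρ τ , _ ,
        op o (instance-extend (↪-interleaveˡ ρ τ) p) (instance-extend (↪-interleaveʳ ρ τ) q)

  name-all : ∀ {n} (σ : Fin n → LatticeTerm A.Carrier) →
             ∃[ ρ ] Σ[ τ ∈ (Fin n → LatticeTerm ℕ) ] ∀ i → Instance ρ (τ i) (σ i)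
  name-all {zero}  σ = (λ _ → A.𝟙) , (λ ()) , λ ()
  name-all {suc n} σ =
    let ρ₀ , t  , p  = name (σ zero)
        ρ₁ , ts , ps = name-all (σ ∘ suc)
        l = ↪-interleaveˡ ρ₀ ρ₁
        r = ↪-interleaveʳ ρ₀ ρ₁
    in  interleave ρ₀ ρ₁ ,
        (λ { zero → rename (proj₁ l) t ; (suc i) → rename (proj₁ r) (ts i) }) ,
        (λ { zero → instance-extend l p ; (suc i) → instance-extend r (ps i) })

  -- Elements of `A` are replaced by variables along the whole derivation: subderivations come with
  -- their own environments, which are interleaved wherever two of them meet.
  lift : ∀ {s t} → s ∼ t →
         ∃[ ρ ] ∃[ s′ ] ∃[ t′ ] Instance ρ s′ s × Instance ρ t′ t × Theory ρ s′ t′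
  lift (premise (diagram ρ {u} {v} h p q)) = ρ , _ , _ , p , q , premise (embed {s = u} {t = v} h)
  lift (axiom {s} {t} α σ) =
    let ρ , τ , h = name-all σ
    in  ρ , _ , _ , instance-bind h s , instance-bind h t , axiom α τ
  lift (refl {s}) = let ρ , s′ , p = name s in ρ , s′ , s′ , p , p , refl
  lift (sym d)    = let ρ , s′ , t′ , p , q , d′ = lift d in ρ , t′ , s′ , q , p , sym d′
  lift (trans d e) =
    let ρ , _ , _ , p , q  , d′ = lift d
        τ , _ , _ , r , s  , e′ = lift e
        l = ↪-interleaveˡ ρ τ
        m = ↪-interleaveʳ ρ τ
    in  interleave ρ τ , _ , _ , instance-extend l p , instance-extend m s ,
        trans (theory-extend l d′)
          -- The two subderivations may name the middle term differently; both names have the same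
          -- instance, so the merged theory equates them.
          (trans (common-instance (instance-extend l q) (instance-extend m r)) (theory-extend m e′))
  lift (op-cong o d e) =
    let ρ , _ , _ , p , q  , d′ = lift d
        τ , _ , _ , r , s  , e′ = lift e
        l = ↪-interleaveˡ ρ τ
        m = ↪-interleaveʳ ρ τ
    in  interleave ρ τ , _ , _ ,
        op o (instance-extend l p) (instance-extend m r) ,
        op o (instance-extend l q) (instance-extend m s) ,
        op-cong o (theory-extend l d′) (theory-extend m e′)

  -- Terms with instances `gen a` and `gen b` must be variables. By compactness the lifted
  -- derivation uses finitely many equations true at `ρ`, so it witnesses a quasi-equation in
  -- `Valid`, which `A` satisfies.
  conservative : (∀ q → q ∈ Valid → Satisfies A q) → ∀ {a b} → gen a ∼ gen b → a A.≈ b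
  conservative A⊨Valid d with lift d
  ... | ρ , _ , _ , gen {i} p , gen {j} q , d′ =
    let ps , hs , d″ = compactness d′
    in  A.trans (A.sym p) (A.trans (A⊨Valid (ps ⟹ (var i ≐ var j)) d″ ρ hs) q)

  -- The embedding of `A` into its envelope.

  gen-cong : ∀ {a b} → a A.≈ b → gen a ∼ gen b
  -- Variable 0 has value `a`, and through `p` it also has `gen b` as an instance.
  gen-cong {a} p = premise (diagram (λ _ → a) {var 0} {var 0} A.refl (gen A.refl) (gen p))

  gen-⇒ : ∀ a b → gen (a A.⇒ b) ∼ gen a ⊸ gen b
  gen-⇒ a b = premise (diagram ρ {var 0} {var 1 ⇒ var 2} A.refl
                (gen A.refl) (op arrow (gen A.refl) (gen A.refl)))
    where
    ρ : Environment
    ρ 0 = a A.⇒ b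
    ρ 1 = a
    ρ _ = b

  gen-𝟙 : gen A.𝟙 ∼ ⊤
  gen-𝟙 = premise (diagram (λ _ → A.𝟙) {var 0} {𝟙} A.refl (gen A.refl) (const top))

  private
    -- Axioms are stated over three variables; laws in fewer variables repeat an argument. On a
    -- concrete vector `lookup` computes, so each instance reduces to the type of its field.
    law : ∀ {s t} → Axiom s t → ∀ p q r →
          bind (lookup (p ∷ q ∷ r ∷ [])) s ∼ bind (lookup (p ∷ q ∷ r ∷ [])) t
    law α p q r = axiom α (lookup (p ∷ q ∷ r ∷ []))

  envelope : SubresiduatedLattice ℓ
  envelope = record
    { Carrier = LatticeTerm A.Carrier
    ; _≈_     = _∼_
    ; _∧_     = _⋏_
    ; _∨_     = _⋎_
    ; _⇒_     = _⊸_
    ; 𝟘       = ⊥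
    ; 𝟙       = ⊤
    ; isDistributiveLattice = record
      { isLattice = record
        { isEquivalence = record { refl = refl ; sym = sym ; trans = trans }
        ; ∨-comm     = λ p q → law ∨-comm p q q
        ; ∨-assoc    = law ∨-assoc
        ; ∨-cong     = op-cong join
        ; ∧-comm     = λ p q → law ∧-comm p q q
        ; ∧-assoc    = law ∧-assoc
        ; ∧-cong     = op-cong meet
        ; absorptive = (λ p q → law ∨-absorbs-∧ p q q) , (λ p q → law ∧-absorbs-∨ p q q)
        }
      ; ∨-distrib-∧ = law ∨-distribˡ-∧ , law ∨-distribʳ-∧
      ; ∧-distrib-∨ = law ∧-distribˡ-∨ , law ∧-distribʳ-∨
      }
    ; minimum       = λ p → law minimum p p p
    ; maximum       = λ p → law maximum p p p
    ; ⇒-cong        = op-cong arrow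
    ; ⇒-refl        = λ p → law ⇒-refl p p p
    ; ⇒-persistent  = law ⇒-persistent
    ; ⇒-modusPonens = λ p q → law ⇒-modusPonens p q q
    ; ⇒-distribˡ-∧  = law ⇒-distribˡ-∧
    ; ⇒-distribʳ-∨  = law ⇒-distribʳ-∨
    ; ⇒-trans       = law ⇒-trans
    }

  generators : Subalgebra envelope
  generators = record
    -- Saturating the generators under `∼` makes the predicate respect equality; the witness `a`
    -- later serves as the image in `A`.
    { member   = λ s → ∃[ a ] s ∼ gen a
    ; respects = λ s∼t (a , s∼a) → a , trans (sym s∼t) s∼a
    ; closed   = λ (a , s∼a) (b , t∼b) →
                   a A.⇒ b , trans (op-cong arrow s∼a t∼b) (sym (gen-⇒ a b))
    ; nonempty = ⊤ , A.𝟙 , sym gen-𝟙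
    }

  generators-≅ : (∀ q → q ∈ Valid → Satisfies A q) → Subalgebra.algebra generators ≅ A
  generators-≅ A⊨Valid = index , record
    { isRelIsomorphism = record
      { isMonomorphism = record
        { isHomomorphism = record { cong = λ {p q} → index-cong p q }
        ; injective      = λ {(_ , _ , s∼a)} {(_ , _ , t∼b)} a≈b →
                             trans s∼a (trans (gen-cong a≈b) (sym t∼b))
        }
      ; surjective = λ a → (gen a , a , refl) , λ {p} → index-cong p (gen a , a , refl)
      }
    ; ⇒-homo = λ _ _ → A.refl
    -- `𝟙-member` obtains the unit as an implication of the chosen element with itself, so its index
    -- is `A.𝟙 A.⇒ A.𝟙`; that this equals `A.𝟙` is derived in the envelope and brought back by
    -- conservativity.
    ; 𝟙-homo = conservative A⊨Valid (trans (gen-⇒ A.𝟙 A.𝟙)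
                 (trans (law ⇒-refl (gen A.𝟙) (gen A.𝟙) (gen A.𝟙)) (sym gen-𝟙)))
    }
    where
    module G = Algebra (Subalgebra.algebra generators)

    index : G.Carrier → A.Carrier
    index (_ , a , _) = a

    index-cong : ∀ p q → p G.≈ q → index p A.≈ index q
    index-cong (_ , _ , s∼a) (_ , _ , t∼b) s∼t =
      conservative A⊨Valid (trans (sym s∼a) (trans s∼t t∼b))

corollary3p25 : ∀ (ℓ : Level) → IsQuasivariety (IsSubreduct {ℓ})
corollary3p25 ℓ = Valid , λ A → mk⇔
  (λ (B , S , S≅A) q q∈Valid →
     satisfies-resp-≅ S≅A q (Soundness.subalgebra-satisfies B S q q∈Valid))
  (λ A⊨Valid → let open Envelope A in envelope , generators , generators-≅ A⊨Valid)
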